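{- Label the hyperedges so that $|h_1|\le|h_2|\le\dots\le|h_M|$. If $N\ge2$ and $M\ge2$, then $$\lambda_{N-1}\le\max\{|h_M|-1,\ |h_{M-1}|\}.$$ More generally, for every integer $k$ with $1\le k\le\min(N,M)-1$, $$\lambda_{N-k}\le\max_{i=0,\dots,k}\bigl(|h_{M-i}|-k+i\bigr).$$
   Context: Let $\Gamma=(V,H,\mathcal C)$ be a hypergraph with real coefficients: $V=\{v_1,\dots,v_N\}$ is a finite set of vertices, $H=(h_1,\dots,h_M)$ is a finite family of non-empty subsets $h_j\subseteq V$ called hyperedges (repetitions allowed; hyperedges are distinguished by their index), and $\mathcal C=\{C_{v,h}\in\mathbb R\}$ is a family of real coefficients with $C_{v,h}=0$ if and only if $v\notin h$. Standing assumptions: every vertex lies in at least one hyperedge, and $\Gamma$ is connected. The degree of $v$ is $\deg v=\sum_{h\in H}C_{v,h}^2>0$. The vertex normalized Laplacian is $Lf(v)=\frac{1}{\deg v}\sum_{h\in H}C_{v,h}\sum_{w\in V}C_{w,h}f(w)$; its eigenvalues are $\lambda_1\le\dots\le\lambda_N$. The cardinality $|h|$ of a hyperedge is its number of vertices. -}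

module Defs where

open import Level using (_⊔_) renaming (suc to lsuc)
open import Data.Nat.Base as ℕ using (ℕ; zero; suc)
import Data.Nat.Properties as ℕₚ
open import Data.Integer.Base as ℤ using (ℤ; +_; -[1+_])
open import Data.Fin.Base as Fin using (Fin; zero; suc; toℕ; fromℕ<; opposite)
open import Data.Fin.Properties using (toℕ<n)
open import Data.Fin.Subset using (Subset; Nonempty; _∈_; _∉_; ∣_∣)
open import Data.Fin.Permutation using (Permutation′; _⟨$⟩ʳ_)
open import Data.Product.Base using (_×_; _,_; ∃-syntax; Σ-syntax; proj₁)
open import Data.Sum.Base using (_⊎_; inj₁; inj₂; [_,_]′)
open import Data.Vec.Base using (foldr₁; tabulate)
open import Function.Base using (_∘_)
open import Relation.Nullary using (¬_; contradiction)
open import Relation.Binary.Core using (Rel)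
open import Relation.Binary.Structures using (IsStrictPartialOrder)
open import Relation.Binary.Construct.Closure.ReflexiveTransitive using (Star)
open import Algebra.Bundles using (CommutativeRing)
open import Algebra.Apartness.Bundles using (HeytingField)
import Algebra.Apartness.Properties.HeytingCommutativeRing as HeytingProperties
import Algebra.Properties.CommutativeMonoid.Sum as SumOver
import Algebra.Properties.Monoid.Mult as MultOver
import Algebra.Properties.Ring as RingProperties

-- The real numbers, axiomatised as a Cauchy complete Archimedean ordered
-- field.  Classically these axioms determine ℝ up to isomorphism.  No
-- decidability is assumed: the strict order is the primitive relation and
-- x ≤ y means ¬ (y < x), so the constructive reals satisfy the axioms too.
record RealField c ℓ₁ ℓ₂ : Set (lsuc (c ⊔ ℓ₁ ⊔ ℓ₂)) where
  infix 4 _<_ _≤_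
  field
    heytingField : HeytingField c ℓ₁ ℓ₂

  open HeytingField heytingField public renaming (zero to *-zero)

  commutativeRing : CommutativeRing c ℓ₁
  commutativeRing = record { isCommutativeRing = isCommutativeRing }

  open CommutativeRing commutativeRing public
    using (ring; +-monoid; +-commutativeMonoid)
  open MultOver +-monoid public using () renaming (_×_ to _⨯_)
  open SumOver +-commutativeMonoid public using (sum)

  field
    _<_                  : Rel Carrier ℓ₂
    isStrictPartialOrder : IsStrictPartialOrder _≈_ _<_
    <⇒#                  : ∀ {x y} → x < y → x # y
    #⇒<⊎>                : ∀ {x y} → x # y → (x < y) ⊎ (y < x)
    +-monoˡ-<            : ∀ {x y} z → x < y → x + z < y + z
    *-pos                : ∀ {x y} → 0# < x → 0# < y → 0# < x * y
    archimedean          : ∀ x → ∃[ n ] x < n ⨯ 1#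

  -- Exchanging m and n shows that this bounds ∣ s m - s n ∣.
  Cauchy : (ℕ → Carrier) → Set (c ⊔ ℓ₂)
  Cauchy s = ∀ ε → 0# < ε → ∃[ n₀ ] (∀ m n → n₀ ℕ.≤ m → n₀ ℕ.≤ n → s m - s n < ε)

  _ConvergesTo_ : (ℕ → Carrier) → Carrier → Set (c ⊔ ℓ₂)
  s ConvergesTo l =
    ∀ ε → 0# < ε → ∃[ n₀ ] (∀ n → n₀ ℕ.≤ n → (s n - l < ε) × (l - s n < ε))

  field
    complete : ∀ s → Cauchy s → ∃[ l ] s ConvergesTo l

  _≤_ : Rel Carrier ℓ₂
  x ≤ y = ¬ (y < x)

  fromℤ : ℤ → Carrier
  fromℤ (+ n)    = n ⨯ 1#
  fromℤ -[1+ n ] = - (suc n ⨯ 1#)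

  open IsStrictPartialOrder isStrictPartialOrder public
    using (<-respʳ-≈; <-respˡ-≈)
    renaming (irrefl to <-irrefl; trans to <-trans)

  open HeytingProperties (HeytingField.heytingCommutativeRing heytingField) public
    using (invertibleˡ⇒#; x-0≈x)
  open RingProperties ring
    using (-‿distribˡ-*; -‿distribʳ-*; -‿involutive)

  <-cotrans : ∀ {x y} → x < y → ∀ z → (x < z) ⊎ (z < y)
  <-cotrans x<y z with #-cotrans (<⇒# x<y) z
  ... | inj₁ x#z = [ inj₁ , (λ z<x → inj₂ (<-trans z<x x<y)) ]′ (#⇒<⊎> x#z)
  ... | inj₂ z#y = [ inj₂ , (λ y<z → inj₁ (<-trans x<y y<z)) ]′ (#⇒<⊎> z#y)

  x<0⇒0<-x : ∀ {x} → x < 0# → 0# < - x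
  x<0⇒0<-x {x} x<0 =
    <-respˡ-≈ (-‿inverseʳ x) (<-respʳ-≈ (+-identityˡ (- x)) (+-monoˡ-< (- x) x<0))

  x#0⇒0<x² : ∀ {x} → x # 0# → 0# < x * x
  x#0⇒0<x² {x} x#0 with #⇒<⊎> x#0
  ... | inj₂ 0<x = *-pos 0<x 0<x
  ... | inj₁ x<0 = <-respʳ-≈ -x*-x≈x*x (*-pos (x<0⇒0<-x x<0) (x<0⇒0<-x x<0))
    where
    -x*-x≈x*x : (- x) * (- x) ≈ x * x
    -x*-x≈x*x = trans (sym (-‿distribˡ-* x (- x)))
               (trans (-‿cong (sym (-‿distribʳ-* x x))) (-‿involutive (x * x)))

  0≤x² : ∀ x → 0# ≤ x * x
  0≤x² x x²<0 = <-irrefl refl (<-trans x²<0 (x#0⇒0<x² x#0))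
    where
    x#0 : x # 0#
    x#0 with #⇒invertible (<⇒# x²<0)
    ... | y , y*x²≈1 , _ = invertibleˡ⇒#
      ( y * x
      , trans (*-congˡ (x-0≈x x))
       (trans (*-assoc y x x)
       (trans (*-congˡ (sym (x-0≈x (x * x)))) y*x²≈1)))

  +-pos-nonneg : ∀ {x y} → 0# < x → 0# ≤ y → 0# < x + y
  +-pos-nonneg {x} {y} 0<x 0≤y with <-cotrans 0<x (x + y)
  ... | inj₁ 0<x+y = 0<x+y
  ... | inj₂ x+y<x = contradiction y<0 0≤y
    where
    y<0 : y < 0#
    y<0 = <-respʳ-≈ (-‿inverseʳ x)
      (<-respˡ-≈ (trans (+-congʳ (+-comm x y))
                 (trans (+-assoc y x (- x))
                 (trans (+-congˡ (-‿inverseʳ x)) (+-identityʳ y))))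
        (+-monoˡ-< (- x) x+y<x))

  sum-nonneg : ∀ {n} (f : Fin n → Carrier) → (∀ i → 0# ≤ f i) → 0# ≤ sum f
  sum-nonneg {zero}  f 0≤f 0<0 = <-irrefl refl 0<0
  sum-nonneg {suc n} f 0≤f s<0 with <-cotrans s<0 (f zero)
  ... | inj₂ f₀<0 = 0≤f zero f₀<0
  ... | inj₁ s<f₀ = sum-nonneg (f ∘ suc) (0≤f ∘ suc)
    (<-respʳ-≈ (-‿inverseʳ (f zero))
      (<-respˡ-≈ (trans (+-congʳ (+-comm (f zero) t))
                 (trans (+-assoc t (f zero) (- f zero))
                 (trans (+-congˡ (-‿inverseʳ (f zero))) (+-identityʳ t))))
        (+-monoˡ-< (- f zero) s<f₀)))
    where
    t = sum (f ∘ suc)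

  sum-pos : ∀ {n} (f : Fin n → Carrier) → (∀ i → 0# ≤ f i) →
            ∀ j → 0# < f j → 0# < sum f
  sum-pos f 0≤f zero    0<fj = +-pos-nonneg 0<fj (sum-nonneg (f ∘ suc) (0≤f ∘ suc))
  sum-pos f 0≤f (suc j) 0<fj =
    <-respʳ-≈ (+-comm (sum (f ∘ suc)) (f zero))
      (+-pos-nonneg (sum-pos (f ∘ suc) (0≤f ∘ suc) j 0<fj) (0≤f zero))

module _ {c ℓ₁ ℓ₂} (ℝ : RealField c ℓ₁ ℓ₂) where
  open RealField ℝ

  -- "C v j ≠ 0" is apartness from 0; classically this is ¬ (C v j ≈ 0#).
  record Hypergraph (N M : ℕ) : Set (c ⊔ ℓ₁ ⊔ ℓ₂) where
    field
      edge     : Fin M → Subset N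
      nonempty : ∀ j → Nonempty (edge j)
      C        : Fin N → Fin M → Carrier
      v∉h⇒C≈0  : ∀ {v j} → v ∉ edge j → C v j ≈ 0#
      v∈h⇒C#0  : ∀ {v j} → v ∈ edge j → C v j # 0#
      covered  : ∀ v → ∃[ j ] v ∈ edge j

    Adjacent : Fin N → Fin N → Set
    Adjacent v w = ∃[ j ] (v ∈ edge j × w ∈ edge j)

    field
      connected : ∀ v w → Star Adjacent v w

    -- ∣h_j∣ once the hyperedges have been relabelled by π.
    card : Permutation′ M → Fin M → ℕ
    card π j = ∣ edge (π ⟨$⟩ʳ j) ∣

    deg : Fin N → Carrier
    deg v = sum (λ j → C v j * C v j)

    deg#0 : ∀ v → deg v # 0#
    deg#0 v with covered v
    ... | j , v∈h = #-sym (<⇒#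
      (sum-pos (λ i → C v i * C v i) (λ i → 0≤x² (C v i)) j (x#0⇒0<x² (v∈h⇒C#0 v∈h))))

    -- #⇒invertible inverts deg v - 0#, which equals deg v.
    1/deg : Fin N → Carrier
    1/deg v = proj₁ (#⇒invertible (deg#0 v))

    laplacian : (Fin N → Carrier) → (Fin N → Carrier)
    laplacian f v =
      1/deg v * sum (λ j → C v j * sum (λ w → C w j * f w))

  HasDimension : ∀ {N p} → ((Fin N → Carrier) → Set p) → ℕ → Set (c ⊔ ℓ₁ ⊔ p)
  HasDimension {N} P m = Σ[ e ∈ (Fin m → Fin N → Carrier) ]
      (∀ i → P (e i))
    × (∀ (a : Fin m → Carrier) →
         (∀ v → sum (λ i → a i * e i v) ≈ 0#) → ∀ i → a i ≈ 0#)
    × (∀ f → P f → Σ[ a ∈ (Fin m → Carrier) ]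
         (∀ v → f v ≈ sum (λ i → a i * e i v)))

  Eigenspace : ∀ {N} → ((Fin N → Carrier) → (Fin N → Carrier)) →
               Carrier → (Fin N → Carrier) → Set ℓ₁
  Eigenspace T x f = ∀ v → T f v ≈ x * f v

  -- ev lists the eigenvalues of T in nondecreasing order, counted with
  -- multiplicity: any x occurs in the list as often as the dimension of its
  -- eigenspace.  S is the set of positions at which x occurs; it is passed in,
  -- not computed, since equality of reals is not assumed decidable.
  -- With S empty: an x not on the list has a zero eigenspace.
  record IsSpectrum {N : ℕ} (T : (Fin N → Carrier) → (Fin N → Carrier))
                    (ev : Fin N → Carrier) : Set (c ⊔ ℓ₁ ⊔ ℓ₂) where
    field
      sorted       : ∀ {i j} → i Fin.≤ j → ev i ≤ ev j
      multiplicity : ∀ x (S : Subset N) →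
                     (∀ {i} → i ∈ S → ev i ≈ x) →
                     (∀ {i} → i ∉ S → ev i # x) →
                     HasDimension (Eigenspace T x) ∣ S ∣

-- Entry n - k of a family indexed by 1, …, n; Fin n starts at 0.
fromTop : ∀ {n} k → k ℕ.< n → Fin n
fromTop k k<n = opposite (fromℕ< k<n)

maxℤ : ∀ {k} → (Fin (suc k) → ℤ) → ℤ
maxℤ t = foldr₁ ℤ._⊔_ (tabulate t)

toℕ<M : ∀ {k M} (i : Fin (suc k)) → k ℕ.< M → toℕ i ℕ.< M
toℕ<M i k<M = ℕₚ.<-≤-trans (toℕ<n i) k<M

{-# OPTIONS --safe #-}

-- The term i = k of the maximum is |h_{M-k}|, so it is enough that λ_{N-k} ≤ b
-- whenever all but k hyperedges have at most b vertices.  Suppose b < λ_{N-k}.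
-- Eigenvectors for the k+1 largest eigenvalues span a space of dimension k+1,
-- which contains some f ≠ 0 with Σ_w C_{w,h} f(w) = 0 for the k exceptional h.
-- By Cauchy–Schwarz on the other hyperedges, Σ_h (Σ_w C_{w,h} f(w))² is at most
-- b Σ_v deg(v) f(v)²; but splitting f into its mutually orthogonal
-- eigencomponents shows that it is larger.
--
-- Since x ≤ y is the negation of y < x, finitely many undecidable comparisons
-- of reals may be decided, under a double negation, on the way.
module Submission where

open import Defs
open import Data.Nat.Base as ℕ using (ℕ; zero; suc; z≤n; s≤s)
import Data.Nat.Properties as ℕ
open import Data.Nat.Properties using (<⇒≤)
open import Data.Integer.Base as ℤ using (+_)
import Data.Integer.Properties as ℤ
open import Data.Bool.Base using (true; false)
open import Data.Fin.Base as Fin using (Fin; zero; suc; toℕ; fromℕ; fromℕ<; opposite; punchIn; punchOut)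
import Data.Fin.Properties as Fin
open import Data.Fin.Permutation using (Permutation′; _⟨$⟩ʳ_; _⟨$⟩ˡ_; inverseʳ)
open import Data.Fin.Subset using (Subset; _∈_; _∉_; ∣_∣)
open import Data.Vec.Base as Vec using ([]; _∷_; here; there)
import Data.Vec.Properties as Vec
open import Data.Product.Base using (_×_; _,_; ∃-syntax; Σ-syntax; proj₁; proj₂)
open import Data.Sum.Base using (_⊎_; inj₁; inj₂; [_,_]′)
open import Effect.Monad using (RawMonad)
open import Function.Base using (_∘_; id)
open import Level using (Level)
open import Relation.Binary.Core using (Rel)
open import Relation.Binary.Structures using (IsEquivalence)
open import Relation.Binary.PropositionalEquality as ≡ using (_≡_; _≢_)
open import Relation.Nullary using (¬_; Dec; yes; no; does; contradiction)
open import Relation.Nullary.Decidable using (dec-true)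
open import Relation.Nullary.Negation using (¬¬-Monad)
open import Algebra.Bundles using (CommutativeRing)
import Algebra.Apartness.Properties.HeytingCommutativeRing as HeytingProperties
import Algebra.Properties.CommutativeMonoid.Sum as CommutativeMonoidSum
import Algebra.Properties.Ring as RingProperties
import Algebra.Properties.Semiring.Sum as SemiringSum
import Algebra.Solver.Ring.NaturalCoefficients.Default as SemiringSolver
import Relation.Binary.Reasoning.Setoid as SetoidReasoning

private variable
  p q : Level

-- Finite choice and class representatives.

¬¬-sequence : ∀ {n} {P : Fin n → Set p} → (∀ i → ¬ ¬ P i) → ¬ ¬ (∀ i → P i)
¬¬-sequence = Fin.sequence (RawMonad.rawApplicative ¬¬-Monad)

all⊎any : ∀ {n} {P : Fin n → Set p} {Q : Fin n → Set q} →
          (∀ i → P i ⊎ Q i) → (∀ i → P i) ⊎ ∃[ i ] Q i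
all⊎any {n = zero}  P⊎Q = inj₁ λ ()
all⊎any {n = suc n} P⊎Q with P⊎Q zero | all⊎any (P⊎Q ∘ suc)
... | inj₂ q₀ | _             = inj₂ (zero , q₀)
... | inj₁ _  | inj₂ (i , qᵢ) = inj₂ (suc i , qᵢ)
... | inj₁ p₀ | inj₁ ps       = inj₁ λ { zero → p₀ ; (suc i) → ps i }

-- The recursion picks the least member of each class. Since `rep i ~ i`, the congruence makes `rep`
-- idempotent, so `rep r ≡ r` recognises the chosen indices.
representatives : ∀ {n} {_~_ : Rel (Fin n) p} → IsEquivalence _~_ → (∀ i j → Dec (i ~ j)) →
                  Σ[ rep ∈ (Fin n → Fin n) ]
                    (∀ i → rep i ~ i) × (∀ {i j} → i ~ j → rep i ≡ rep j)
representatives {n = zero} eq dec = (λ ()) , (λ ()) , λ { {()} }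
representatives {n = suc n} {_~_} eq dec = rep , rep~ , rep-cong
  where
  open IsEquivalence eq
  tail = representatives {_~_ = λ i j → suc i ~ suc j}
    (record { refl = refl ; sym = sym ; trans = trans }) (λ i j → dec (suc i) (suc j))
  rep : Fin (suc n) → Fin (suc n)
  rep zero = zero
  rep (suc i) with dec zero (suc i)
  ... | yes _ = zero
  ... | no _  = suc (proj₁ tail i)
  rep~ : ∀ i → rep i ~ i
  rep~ zero = refl
  rep~ (suc i) with dec zero (suc i)
  ... | yes 0~i = 0~i
  ... | no _    = proj₁ (proj₂ tail) i
  rep-cong : ∀ {i j} → i ~ j → rep i ≡ rep j
  rep-cong {zero}  {zero}  _ = ≡.refl
  rep-cong {zero}  {suc j} 0~j with dec zero (suc j)
  ... | yes _  = ≡.refl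
  ... | no 0≁j = contradiction 0~j 0≁j
  rep-cong {suc i} {zero}  i~0 with dec zero (suc i)
  ... | yes _  = ≡.refl
  ... | no 0≁i = contradiction (sym i~0) 0≁i
  rep-cong {suc i} {suc j} i~j with dec zero (suc i) | dec zero (suc j)
  ... | yes _   | yes _   = ≡.refl
  ... | yes 0~i | no 0≁j  = contradiction (trans 0~i i~j) 0≁j
  ... | no 0≁i  | yes 0~j = contradiction (trans 0~j (sym i~j)) 0≁i
  ... | no _    | no _    = ≡.cong suc (proj₂ (proj₂ tail) i~j)

-- Families indexed by a subset.

module _ {a} {A : Set a} where

  -- `multiplicity` indexes a basis by `Fin ∣ S ∣`. Padding it to all of `Fin n`, with the members
  -- of `S` in increasing order, lets all eigenspaces share one coefficient vector.
  extend : ∀ {n} (S : Subset n) → (Fin ∣ S ∣ → A) → A → Fin n → A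
  extend (true  ∷ S) g d zero    = g zero
  extend (true  ∷ S) g d (suc i) = extend S (g ∘ suc) d i
  extend (false ∷ S) g d zero    = d
  extend (false ∷ S) g d (suc i) = extend S g d i

  restrict : ∀ {n} (S : Subset n) → (Fin n → A) → Fin ∣ S ∣ → A
  restrict (true  ∷ S) f zero    = f zero
  restrict (true  ∷ S) f (suc j) = restrict S (f ∘ suc) j
  restrict (false ∷ S) f j       = restrict S (f ∘ suc) j

  extend⁺ : ∀ {n} (P : A → Set p) (S : Subset n) {g d} → (∀ j → P (g j)) → P d →
            ∀ i → P (extend S g d i)
  extend⁺ P (true  ∷ S) Pg Pd zero    = Pg zero
  extend⁺ P (true  ∷ S) Pg Pd (suc i) = extend⁺ P S (Pg ∘ suc) Pd i
  extend⁺ P (false ∷ S) Pg Pd zero    = Pd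
  extend⁺ P (false ∷ S) Pg Pd (suc i) = extend⁺ P S Pg Pd i

  extend-∉ : ∀ {n} (S : Subset n) {g d i} → i ∉ S → extend S g d i ≡ d
  extend-∉ (true  ∷ S) {i = zero}  0∉S = contradiction here 0∉S
  extend-∉ (true  ∷ S) {i = suc i} i∉S = extend-∉ S (i∉S ∘ there)
  extend-∉ (false ∷ S) {i = zero}  _   = ≡.refl
  extend-∉ (false ∷ S) {i = suc i} i∉S = extend-∉ S (i∉S ∘ there)

  restrict⁻ : ∀ {n} (P : A → Set p) (S : Subset n) {f} → (∀ j → P (restrict S f j)) →
              ∀ {i} → i ∈ S → P (f i)
  restrict⁻ P (true  ∷ S) Pf here        = Pf zero
  restrict⁻ P (true  ∷ S) Pf (there i∈S) = restrict⁻ P S (Pf ∘ suc) i∈S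
  restrict⁻ P (false ∷ S) Pf (there i∈S) = restrict⁻ P S Pf i∈S

-- Order and arithmetic of the reals.

module RealFieldProperties {c ℓ₁ ℓ₂} (ℝ : RealField c ℓ₁ ℓ₂) where
  open RealField ℝ
  open CommutativeRing commutativeRing using (semiring; commutativeSemiring)
  open CommutativeMonoidSum +-commutativeMonoid
    using (∑-distrib-+; ∑-comm; sum-remove; sum-replicate-zero) renaming (sum-cong-≋ to sum-cong)
  open HeytingProperties heytingCommutativeRing using (1#0)
  open RingProperties ring using (-‿distribˡ-*; -‿distribʳ-*)
  open SemiringSum semiring using (*-distribˡ-sum; *-distribʳ-sum)
  open SemiringSolver commutativeSemiring using (solve; _:+_; _:*_; _:=_; con)
  open SetoidReasoning setoid

  Vector : ℕ → Set c
  Vector n = Fin n → Carrier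

  ≤-reflexive : ∀ {x y} → x ≈ y → x ≤ y
  ≤-reflexive x≈y y<x = <-irrefl (sym x≈y) y<x

  ≤-trans : ∀ {x y z} → x ≤ y → y ≤ z → x ≤ z
  ≤-trans {y = y} x≤y y≤z z<x = [ y≤z , x≤y ]′ (<-cotrans z<x y)

  <-≤-trans : ∀ {x y z} → x < y → y ≤ z → x < z
  <-≤-trans {z = z} x<y y≤z = [ id , (λ z<y → contradiction z<y y≤z) ]′ (<-cotrans x<y z)

  <⇒≤ᵣ : ∀ {x y} → x < y → x ≤ y
  <⇒≤ᵣ x<y y<x = <-irrefl refl (<-trans x<y y<x)

  ≤-resp-≈ : ∀ {x x′ y y′} → x ≈ x′ → y ≈ y′ → x ≤ y → x′ ≤ y′
  ≤-resp-≈ x≈x′ y≈y′ x≤y y′<x′ = x≤y (<-respˡ-≈ (sym y≈y′) (<-respʳ-≈ (sym x≈x′) y′<x′))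

  -- Tightness turns a refutation of `x # y` into `x ≈ y`, so the two alternatives cannot both be
  -- refuted.
  ≈⊎# : ∀ x y → ¬ ¬ (x ≈ y ⊎ x # y)
  ≈⊎# x y k = k (inj₁ (proj₁ (tight x y) (k ∘ inj₂)))

  <⊎≈⊎> : ∀ x y → ¬ ¬ (x < y ⊎ x ≈ y ⊎ y < x)
  <⊎≈⊎> x y k = ≈⊎# x y λ
    { (inj₁ x≈y) → k (inj₂ (inj₁ x≈y))
    ; (inj₂ x#y) → [ k ∘ inj₁ , k ∘ inj₂ ∘ inj₂ ]′ (#⇒<⊎> x#y) }

  x-y+y≈x : ∀ x y → (x - y) + y ≈ x
  x-y+y≈x x y = trans (+-assoc x (- y) y) (trans (+-congˡ (-‿inverseˡ y)) (+-identityʳ x))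

  x+y-y≈x : ∀ x y → (x + y) - y ≈ x
  x+y-y≈x x y = trans (+-assoc x y (- y)) (trans (+-congˡ (-‿inverseʳ y)) (+-identityʳ x))

  +-cancelʳ-< : ∀ {x y} z → x + z < y + z → x < y
  +-cancelʳ-< z x+z<y+z =
    <-respˡ-≈ (x+y-y≈x _ z) (<-respʳ-≈ (x+y-y≈x _ z) (+-monoˡ-< (- z) x+z<y+z))

  +-monoʳ-≤ : ∀ {x y} z → x ≤ y → z + x ≤ z + y
  +-monoʳ-≤ z x≤y = x≤y ∘ +-cancelʳ-< z ∘ <-respˡ-≈ (+-comm _ _) ∘ <-respʳ-≈ (+-comm _ _)

  +-monoˡ-≤ : ∀ {x y} z → x ≤ y → x + z ≤ y + z
  +-monoˡ-≤ z x≤y = x≤y ∘ +-cancelʳ-< z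

  +-mono-≤ : ∀ {x y u v} → x ≤ y → u ≤ v → x + u ≤ y + v
  +-mono-≤ {y = y} {u} x≤y u≤v = ≤-trans (+-monoˡ-≤ u x≤y) (+-monoʳ-≤ y u≤v)

  +-mono-<-≤ : ∀ {x y u v} → x < y → u ≤ v → x + u < y + v
  +-mono-<-≤ {y = y} {u} x<y u≤v = <-≤-trans (+-monoˡ-< u x<y) (+-monoʳ-≤ y u≤v)

  +-mono-≤-< : ∀ {x y u v} → x ≤ y → u < v → x + u < y + v
  +-mono-≤-< x≤y u<v =
    <-respˡ-≈ (+-comm _ _) (<-respʳ-≈ (+-comm _ _) (+-mono-<-≤ u<v x≤y))

  *-monoʳ-< : ∀ {x y z} → 0# < z → x < y → z * x < z * y
  *-monoʳ-< {x} {y} {z} 0<z x<y =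
    <-respˡ-≈ (+-identityˡ (z * x)) (<-respʳ-≈ z[y-x]+zx≈zy
      (+-monoˡ-< (z * x) (*-pos 0<z (<-respˡ-≈ (-‿inverseʳ x) (+-monoˡ-< (- x) x<y)))))
    where
    z[y-x]+zx≈zy : z * (y - x) + z * x ≈ z * y
    z[y-x]+zx≈zy = trans (sym (distribˡ z _ _)) (*-congˡ (x-y+y≈x y x))

  -- The conclusion is a negation, so the trichotomy `<⊎≈⊎>` is available, first for the sign of `z`
  -- and then for `x` and `y`.
  *-monoʳ-≤ : ∀ {x y z} → 0# ≤ z → x ≤ y → z * x ≤ z * y
  *-monoʳ-≤ {x} {y} {z} 0≤z x≤y zy<zx = <⊎≈⊎> 0# z λ
    { (inj₂ (inj₂ z<0)) → 0≤z z<0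
    ; (inj₂ (inj₁ 0≈z)) → <-irrefl (trans (*-congʳ (sym 0≈z)) (trans (zeroˡ y)
                            (trans (sym (zeroˡ x)) (*-congʳ 0≈z)))) zy<zx
    ; (inj₁ 0<z) → <⊎≈⊎> x y λ
      { (inj₁ x<y) → <-irrefl refl (<-trans zy<zx (*-monoʳ-< 0<z x<y))
      ; (inj₂ (inj₁ x≈y)) → <-irrefl (*-congˡ (sym x≈y)) zy<zx
      ; (inj₂ (inj₂ y<x)) → x≤y y<x } }

  *-monoˡ-≤ : ∀ {x y z} → 0# ≤ z → x ≤ y → x * z ≤ y * z
  *-monoˡ-≤ 0≤z x≤y = ≤-resp-≈ (*-comm _ _) (*-comm _ _) (*-monoʳ-≤ 0≤z x≤y)

  ⨯1-nonneg : ∀ n → 0# ≤ n ⨯ 1#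
  ⨯1-nonneg zero    = ≤-reflexive refl
  ⨯1-nonneg (suc n) = ≤-resp-≈ (+-identityˡ 0#) refl
    (+-mono-≤ (≤-resp-≈ refl (*-identityˡ 1#) (0≤x² 1#)) (⨯1-nonneg n))

  ⨯1-mono-≤ : ∀ {m n} → m ℕ.≤ n → m ⨯ 1# ≤ n ⨯ 1#
  ⨯1-mono-≤ {n = n} z≤n = ⨯1-nonneg n
  ⨯1-mono-≤ (s≤s m≤n) = +-monoʳ-≤ 1# (⨯1-mono-≤ m≤n)

  ⨯1≤fromℤ : ∀ {n z} → + n ℤ.≤ z → n ⨯ 1# ≤ fromℤ z
  ⨯1≤fromℤ (ℤ.+≤+ m≤n) = ⨯1-mono-≤ m≤n

  #-*-cancel : ∀ {x y z} → x # y → x * z ≈ y * z → z ≈ 0#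
  #-*-cancel {x} {y} {z} x#y xz≈yz with #⇒invertible x#y
  ... | x-y⁻¹ , inv , _ = begin
    z                     ≈⟨ *-identityˡ z ⟨
    1# * z                ≈⟨ *-congʳ inv ⟨
    x-y⁻¹ * (x - y) * z   ≈⟨ *-assoc x-y⁻¹ (x - y) z ⟩
    x-y⁻¹ * ((x - y) * z) ≈⟨ *-congˡ [x-y]z≈0 ⟩
    x-y⁻¹ * 0#            ≈⟨ zeroʳ x-y⁻¹ ⟩
    0#                    ∎
    where
    [x-y]z≈0 : (x - y) * z ≈ 0#
    [x-y]z≈0 = begin
      (x - y) * z     ≈⟨ distribʳ z x (- y) ⟩
      x * z + - y * z ≈⟨ +-cong xz≈yz (sym (-‿distribˡ-* y z)) ⟩
      y * z - y * z   ≈⟨ -‿inverseʳ (y * z) ⟩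
      0#              ∎

  -- Finite sums and dot products.

  sum-zero : ∀ {n} {f : Vector n} → (∀ i → f i ≈ 0#) → sum f ≈ 0#
  sum-zero {n} f≈0 = trans (sum-cong f≈0) (sum-replicate-zero n)

  sum-single : ∀ {n} (f : Vector n) i → (∀ j → j ≢ i → f j ≈ 0#) → sum f ≈ f i
  sum-single {suc n} f i f≈0 = begin
    sum f                              ≈⟨ sum-remove {i = i} f ⟩
    f i + sum (f ∘ punchIn i)          ≈⟨ +-congˡ (sum-zero λ j → f≈0 _ (Fin.punchInᵢ≢i i j)) ⟩
    f i + 0#                           ≈⟨ +-identityʳ (f i) ⟩
    f i                                ∎

  sum-mono-≤ : ∀ {n} {f g : Vector n} → (∀ i → f i ≤ g i) → sum f ≤ sum g
  sum-mono-≤ {zero}  f≤g = ≤-reflexive refl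
  sum-mono-≤ {suc n} f≤g = +-mono-≤ (f≤g zero) (sum-mono-≤ (f≤g ∘ suc))

  sum-mono-< : ∀ {n} {f g : Vector n} → (∀ i → f i ≤ g i) → ∀ i → f i < g i → sum f < sum g
  sum-mono-< f≤g zero    f<g = +-mono-<-≤ f<g (sum-mono-≤ (f≤g ∘ suc))
  sum-mono-< f≤g (suc i) f<g = +-mono-≤-< (f≤g zero) (sum-mono-< (f≤g ∘ suc) i f<g)

  infix 8 _∙_
  _∙_ : ∀ {n} → Vector n → Vector n → Carrier
  x ∙ y = sum (λ i → x i * y i)

  ∙-congˡ : ∀ {n} (x : Vector n) {y y′} → (∀ i → y i ≈ y′ i) → x ∙ y ≈ x ∙ y′
  ∙-congˡ x y≈y′ = sum-cong (λ i → *-congˡ (y≈y′ i))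

  ∙-comm : ∀ {n} (x y : Vector n) → x ∙ y ≈ y ∙ x
  ∙-comm x y = sum-cong (λ i → *-comm (x i) (y i))

  ∙-sum : ∀ {m n} (x : Vector m) (y : Fin n → Vector m) →
          x ∙ (λ i → sum (λ k → y k i)) ≈ sum (λ k → x ∙ y k)
  ∙-sum x y = trans (sum-cong (λ i → *-distribˡ-sum (x i) (λ k → y k i)))
                    (∑-comm (λ i k → x i * y k i))

  ∙-scale : ∀ {n} (x : Vector n) a (y : Vector n) → x ∙ (λ i → a * y i) ≈ a * (x ∙ y)
  ∙-scale x a y = begin
    x ∙ (λ i → a * y i)
      ≈⟨ sum-cong (λ i → solve 3 (λ x a y → x :* (a :* y) := a :* (x :* y)) refl (x i) a (y i)) ⟩
    sum (λ i → a * (x i * y i)) ≈⟨ *-distribˡ-sum a (λ i → x i * y i) ⟨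
    a * (x ∙ y)                 ∎

  combination : ∀ {m n} → Vector n → (Fin n → Vector m) → Vector m
  combination a e v = sum (λ i → a i * e i v)

  ∙-combination : ∀ {m n} (x : Vector m) (a : Vector n) (e : Fin n → Vector m) →
                  x ∙ combination a e ≈ a ∙ (λ i → x ∙ e i)
  ∙-combination x a e =
    trans (∙-sum x (λ i v → a i * e i v)) (sum-cong (λ i → ∙-scale x (a i) (e i)))

  ∙-sumˡ-scale : ∀ {n} (x y z : Vector n) a →
                 (λ i → x i + a * y i) ∙ z ≈ x ∙ z + a * (y ∙ z)
  ∙-sumˡ-scale x y z a = begin
    sum (λ i → (x i + a * y i) * z i)
      ≈⟨ sum-cong (λ i → solve 4 (λ x y z a → (x :+ a :* y) :* z := x :* z :+ a :* (y :* z)) refl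
           (x i) (y i) (z i) a) ⟩
    sum (λ i → x i * z i + a * (y i * z i))
      ≈⟨ ∑-distrib-+ (λ i → x i * z i) (λ i → a * (y i * z i)) ⟩
    x ∙ z + sum (λ i → a * (y i * z i))
      ≈⟨ +-congˡ (*-distribˡ-sum a (λ i → y i * z i)) ⟨
    x ∙ z + a * (y ∙ z) ∎

  -- Homogeneous systems with more unknowns than equations.

  NontrivialZero : ∀ {m n} → (Fin m → Vector n) → Set _
  NontrivialZero A = ∃[ x ] (∃[ i ] x i # 0#) × (∀ j → A j ∙ x ≈ 0#)

  zero-column⇒zero : ∀ {m n} (A : Fin m → Vector (suc n)) → (∀ j → A j zero ≈ 0#) →
                     NontrivialZero A
  zero-column⇒zero {n = n} A A₀≈0 = e₀ , (zero , 1#0) , λ j → begin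
    A j ∙ e₀       ≈⟨ sum-single (λ i → A j i * e₀ i) zero
                        (λ { zero 0≢0 → contradiction ≡.refl 0≢0 ; (suc i) _ → zeroʳ _ }) ⟩
    A j zero * 1#  ≈⟨ *-identityʳ (A j zero) ⟩
    A j zero       ≈⟨ A₀≈0 j ⟩
    0#             ∎
    where
    e₀ : Vector (suc n)
    e₀ zero    = 1#
    e₀ (suc _) = 0#

  -- One step of Gaussian elimination: a multiple of the pivot row `r` clears the first column from
  -- the other rows, then that column and the pivot row are dropped. `b⁻¹` stands for the inverse of
  -- the pivot.
  eliminated : ∀ {m n} → (Fin (suc m) → Vector (suc n)) → Fin (suc m) → Carrier →
               Fin m → Vector n
  eliminated A r b⁻¹ j i =
    A (punchIn r j) (suc i) + - (A (punchIn r j) zero * b⁻¹) * A r (suc i)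

  back-substitute : ∀ {m n} (A : Fin (suc m) → Vector (suc n)) r b⁻¹ → A r zero * b⁻¹ ≈ 1# →
                    NontrivialZero (eliminated A r b⁻¹) → NontrivialZero A
  back-substitute {n = n} A r b⁻¹ bb⁻¹≈1 (x , (i , xᵢ#0) , Ax≈0) = y , (suc i , xᵢ#0) , Ay≈0
    where
    s = (A r ∘ suc) ∙ x
    y : Vector (suc n)
    -- The value that equation `r` forces on the first unknown.
    y zero    = - (b⁻¹ * s)
    y (suc i) = x i
    A₀y₀ : ∀ a → a * - (b⁻¹ * s) ≈ - (a * b⁻¹) * s
    A₀y₀ a = begin
      a * - (b⁻¹ * s)   ≈⟨ -‿distribʳ-* a (b⁻¹ * s) ⟨
      - (a * (b⁻¹ * s)) ≈⟨ -‿cong (*-assoc a b⁻¹ s) ⟨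
      - (a * b⁻¹ * s)   ≈⟨ -‿distribˡ-* (a * b⁻¹) s ⟩
      - (a * b⁻¹) * s   ∎
    Ay≈0 : ∀ j → A j ∙ y ≈ 0#
    Ay≈0 j with j Fin.≟ r
    ... | yes ≡.refl = begin
      A j zero * - (b⁻¹ * s) + s ≈⟨ +-congʳ (A₀y₀ (A j zero)) ⟩
      - (A j zero * b⁻¹) * s + s ≈⟨ +-congʳ (*-congʳ (-‿cong bb⁻¹≈1)) ⟩
      - 1# * s + s               ≈⟨ +-congʳ (-‿distribˡ-* 1# s) ⟨
      - (1# * s) + s             ≈⟨ +-congʳ (-‿cong (*-identityˡ s)) ⟩
      - s + s                    ≈⟨ -‿inverseˡ s ⟩
      0#                         ∎
    -- With the first unknown substituted, row `j` becomes the row of `eliminated` at the `j′` for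
    -- which `punchIn r j′` is `j`.
    ... | no j≢r with punchOut (j≢r ∘ ≡.sym) | Fin.punchIn-punchOut (j≢r ∘ ≡.sym)
    ...   | j′ | ≡.refl = begin
      A j zero * - (b⁻¹ * s) + (A j ∘ suc) ∙ x ≈⟨ +-congʳ (A₀y₀ (A j zero)) ⟩
      - (A j zero * b⁻¹) * s + (A j ∘ suc) ∙ x ≈⟨ +-comm _ _ ⟩
      (A j ∘ suc) ∙ x + - (A j zero * b⁻¹) * s ≈⟨ ∙-sumˡ-scale (A j ∘ suc) (A r ∘ suc) x _ ⟨
      eliminated A r b⁻¹ j′ ∙ x                ≈⟨ Ax≈0 j′ ⟩
      0#                                       ∎

  -- If the first column vanishes, the first unit vector is a solution. Otherwise a pivot removes
  -- one equation and one unknown, so the unknowns stay in excess. The double negation pays for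
  -- deciding which entries of the column are apart from zero.
  kernel : ∀ {m n} → m ℕ.< n → (A : Fin m → Vector n) → ¬ ¬ NontrivialZero A
  pivot  : ∀ {m n} → m ℕ.≤ n → (A : Fin m → Vector (suc n)) → ∃[ r ] A r zero # 0# →
           ¬ ¬ NontrivialZero A

  kernel (s≤s m≤n) A k = ¬¬-sequence (λ j → ≈⊎# (A j zero) 0#)
    λ dec → [ k ∘ zero-column⇒zero A , (λ A₀#0 → pivot m≤n A A₀#0 k) ]′ (all⊎any dec)

  pivot {suc m} m<n A (r , b#0) k with #⇒invertible b#0
  ... | b⁻¹ , _ , inv = kernel m<n (eliminated A r b⁻¹)
    (k ∘ back-substitute A r b⁻¹ (trans (*-congʳ (sym (x-0≈x (A r zero)))) inv))

  -- The first `l` columns are deleted and the solution of the smaller system is padded with zeros;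
  -- `m + l < n` says that the remaining unknowns still outnumber the equations.
  kernel-supported : ∀ {m n} l → m ℕ.+ l ℕ.< n → (A : Fin m → Vector n) →
                     ¬ ¬ (Σ[ (x , _) ∈ NontrivialZero A ] (∀ i → toℕ i ℕ.< l → x i ≈ 0#))
  kernel-supported {m} zero m<n A k =
    kernel (≡.subst (ℕ._< _) (ℕ.+-identityʳ m) m<n) A λ z → k (z , λ _ ())
  kernel-supported {m} {suc n} (suc l) m+l<n A k =
    kernel-supported l (ℕ.s≤s⁻¹ (≡.subst (ℕ._< suc n) (ℕ.+-suc m l) m+l<n)) (λ j → A j ∘ suc)
      λ { ((x , (i , xᵢ#0) , Ax≈0) , supp) →
        k (( (λ { zero → 0# ; (suc i) → x i }) , (suc i , xᵢ#0)
           , (λ j → trans (+-cong (zeroʳ (A j zero)) (Ax≈0 j)) (+-identityˡ 0#)))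
          , λ { zero _ → refl ; (suc i) i<l → supp i (ℕ.s<s⁻¹ i<l) }) }

  -- Cauchy-Schwarz over a finite set.

  cardinal : ∀ {n} → Subset n → Carrier
  cardinal S = ∣ S ∣ ⨯ 1#

  young : ∀ x y → x * y + x * y ≤ x * x + y * y
  young x y = ≤-resp-≈ (+-identityʳ _) (x²≈ x y) (+-monoʳ-≤ _ (0≤x² (x - y)))
    where
    x²≈ : ∀ x y → (x * y + x * y) + (x - y) * (x - y) ≈ x * x + y * y
    x²≈ x y = begin
      -- Writing `x` as `d + y` removes the subtraction and leaves an identity of commutative
      -- semirings.
      (x * y + x * y) + d * d             ≈⟨ +-congʳ (+-cong (*-congʳ x≈) (*-congʳ x≈)) ⟩
      ((d + y) * y + (d + y) * y) + d * d
        ≈⟨ solve 2 (λ d y → ((d :+ y) :* y :+ (d :+ y) :* y) :+ d :* d :=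
                            (d :+ y) :* (d :+ y) :+ y :* y) refl d y ⟩
      (d + y) * (d + y) + y * y           ≈⟨ +-congʳ (*-cong x≈ x≈) ⟨
      x * x + y * y ∎
      where
      d = x - y
      x≈ : x ≈ d + y
      x≈ = sym (x-y+y≈x x y)

  -- The sum over S of the inequalities 0 ≤ (x - yᵢ)².
  young-sum : ∀ {n} (S : Subset n) (y : Vector n) → (∀ {i} → i ∉ S → y i ≈ 0#) → ∀ x →
              x * sum y + x * sum y ≤ cardinal S * (x * x) + y ∙ y
  young-sum [] y y≈0 x = ≤-reflexive
    (solve 1 (λ x → x :* con 0 :+ x :* con 0 := con 0 :* (x :* x) :+ con 0) refl x)
  young-sum (true ∷ S) y y≈0 x = ≤-resp-≈
    (solve 3 (λ x a s → (x :* a :+ x :* a) :+ (x :* s :+ x :* s) := x :* (a :+ s) :+ x :* (a :+ s)) refl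
      x (y zero) (sum (y ∘ suc)))
    (solve 4 (λ x a c q → (x :* x :+ a :* a) :+ (c :* (x :* x) :+ q) :=
                          (con 1 :+ c) :* (x :* x) :+ (a :* a :+ q)) refl
      x (y zero) (cardinal S) ((y ∘ suc) ∙ (y ∘ suc)))
    (+-mono-≤ (young x (y zero)) (young-sum S (y ∘ suc) (λ i∉S → y≈0 λ { (there i∈S) → i∉S i∈S }) x))
  young-sum (false ∷ S) y y≈0 x = ≤-resp-≈
    (+-cong (*-congˡ s≈) (*-congˡ s≈))
    (+-congˡ (trans (sym (+-identityˡ _)) (+-congʳ (sym (trans (*-congʳ y₀≈0) (zeroˡ (y zero)))))))
    (young-sum S (y ∘ suc) (λ i∉S → y≈0 λ { (there i∈S) → i∉S i∈S }) x)
    where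
    y₀≈0 = y≈0 {zero} λ ()
    s≈ : sum (y ∘ suc) ≈ sum y
    s≈ = trans (sym (+-identityˡ _)) (+-congʳ (sym y₀≈0))

  -- Induction on `S`: in `(a + s)² = a² + 2as + s²`, with `a` the first entry and `s` the remaining
  -- sum, `young-sum` at `a` bounds the cross term and the induction hypothesis bounds `s²`.
  cauchy-schwarz : ∀ {n} (S : Subset n) (y : Vector n) → (∀ {i} → i ∉ S → y i ≈ 0#) →
                   sum y * sum y ≤ cardinal S * (y ∙ y)
  cauchy-schwarz [] y y≈0 = ≤-reflexive refl
  cauchy-schwarz (true ∷ S) y y≈0 = ≤-resp-≈
    (solve 2 (λ a s → a :* a :+ ((a :* s :+ a :* s) :+ s :* s) := (a :+ s) :* (a :+ s)) refl
      (y zero) (sum (y ∘ suc)))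
    (solve 3 (λ a c q → a :* a :+ ((c :* (a :* a) :+ q) :+ c :* q) := (con 1 :+ c) :* (a :* a :+ q)) refl
      (y zero) (cardinal S) ((y ∘ suc) ∙ (y ∘ suc)))
    (+-monoʳ-≤ _ (+-mono-≤ (young-sum S (y ∘ suc) y≈0′ (y zero)) (cauchy-schwarz S (y ∘ suc) y≈0′)))
    where
    y≈0′ : ∀ {i} → i ∉ S → y (suc i) ≈ 0#
    y≈0′ i∉S = y≈0 λ { (there i∈S) → i∉S i∈S }
  cauchy-schwarz (false ∷ S) y y≈0 = ≤-resp-≈
    (*-cong s≈ s≈)
    (*-congˡ (trans (sym (+-identityˡ _)) (+-congʳ (sym (trans (*-congʳ y₀≈0) (zeroˡ (y zero)))))))
    (cauchy-schwarz S (y ∘ suc) (λ i∉S → y≈0 λ { (there i∈S) → i∉S i∈S }))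
    where
    y₀≈0 = y≈0 {zero} λ ()
    s≈ : sum (y ∘ suc) ≈ sum y
    s≈ = trans (sym (+-identityˡ _)) (+-congʳ (sym y₀≈0))

  -- `ev ≈# ev` makes equality of the listed eigenvalues decidable; it is available only under a
  -- double negation.
  _≈#_ : ∀ {n} → Vector n → Vector n → Set _
  x ≈# y = ∀ i j → x i ≈ y j ⊎ x i # y j

  -- The degree inner product and the energy form.

  module Coefficients {N M} (C : Fin N → Vector M) where

    φ : Fin M → Vector N → Carrier
    φ j f = (λ w → C w j) ∙ f

    degree : Vector N
    degree v = C v ∙ C v

    -- Weighting by degrees makes the Laplacian self-adjoint.
    ⟨_,_⟩ : Vector N → Vector N → Carrier
    ⟨ g , f ⟩ = g ∙ (λ v → degree v * f v)

    -- deg(v) times the Laplacian of f at v is C v ∙ (λ j → φ j f), so this is ⟨ g , L f ⟩.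
    energy : Vector N → Vector N → Carrier
    energy g f = (λ j → φ j g) ∙ (λ j → φ j f)

    -- The eigenvalue equation multiplied by the degree, so that no inverse occurs. The zero vector
    -- qualifies, which allows empty eigencomponents.
    IsEigenvector : Carrier → Vector N → Set _
    IsEigenvector x f = ∀ v → C v ∙ (λ j → φ j f) ≈ x * (degree v * f v)

    ⟨⟩-sym : ∀ g f → ⟨ g , f ⟩ ≈ ⟨ f , g ⟩
    ⟨⟩-sym g f = sum-cong λ v →
      solve 3 (λ g d f → g :* (d :* f) := f :* (d :* g)) refl (g v) (degree v) (f v)

    ⟨⟩-sumʳ : ∀ {n} g (F : Fin n → Vector N) →
              ⟨ g , (λ v → sum (λ r → F r v)) ⟩ ≈ sum (λ r → ⟨ g , F r ⟩)
    ⟨⟩-sumʳ g F = trans (∙-congˡ g λ v → *-distribˡ-sum (degree v) (λ r → F r v))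
                        (∙-sum g (λ r v → degree v * F r v))

    ⟨⟩-squares : ∀ f → ⟨ f , f ⟩ ≈ sum (λ v → degree v * (f v * f v))
    ⟨⟩-squares f = sum-cong λ v →
      solve 2 (λ d f → f :* (d :* f) := d :* (f :* f)) refl (degree v) (f v)

    degree-nonneg : ∀ v → 0# ≤ degree v
    degree-nonneg v = sum-nonneg (λ j → C v j * C v j) (λ j → 0≤x² (C v j))

    degree*square-nonneg : ∀ (f : Vector N) v → 0# ≤ degree v * (f v * f v)
    degree*square-nonneg f v =
      ≤-resp-≈ (zeroʳ (degree v)) refl (*-monoʳ-≤ (degree-nonneg v) (0≤x² (f v)))

    ⟨⟩-nonneg : ∀ f → 0# ≤ ⟨ f , f ⟩
    ⟨⟩-nonneg f = ≤-resp-≈ refl (sym (⟨⟩-squares f)) (sum-nonneg _ (degree*square-nonneg f))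

    -- A single entry apart from zero already makes the sum of squares positive; tightness does the
    -- rest.
    ⟨⟩-definite : (∀ v → 0# < degree v) → ∀ f → ⟨ f , f ⟩ ≤ 0# → ∀ v → f v ≈ 0#
    ⟨⟩-definite 0<deg f ⟨f,f⟩≤0 v = proj₁ (tight (f v) 0#) λ fv#0 →
      ⟨f,f⟩≤0 (<-respʳ-≈ (sym (⟨⟩-squares f))
        (sum-pos _ (degree*square-nonneg f) v (*-pos (0<deg v) (x#0⇒0<x² fv#0))))

    energy-sumʳ : ∀ {n} g (F : Fin n → Vector N) →
                  energy g (λ v → sum (λ r → F r v)) ≈ sum (λ r → energy g (F r))
    energy-sumʳ g F = trans (∙-congˡ (λ j → φ j g) λ j → ∙-sum (λ w → C w j) F)
                            (∙-sum (λ j → φ j g) (λ r j → φ j (F r)))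

    energy-sym : ∀ g f → energy g f ≈ energy f g
    energy-sym g f = ∙-comm (λ j → φ j g) (λ j → φ j f)

    -- Exchanging the sums over hyperedges and vertices brings out the left side of the eigenvalue
    -- equation of `f`, paired with `g`.
    energy-eigenvector : ∀ {x f} g → IsEigenvector x f → energy g f ≈ x * ⟨ g , f ⟩
    energy-eigenvector {x} {f} g Lf≈xf = begin
      energy g f                                 ≈⟨ energy-sym g f ⟩
      (λ j → φ j f) ∙ (λ j → φ j g)              ≈⟨ ∙-congˡ (λ j → φ j f) (λ j → ∙-comm (λ w → C w j) g) ⟩
      (λ j → φ j f) ∙ combination g C            ≈⟨ ∙-combination (λ j → φ j f) g C ⟩
      g ∙ (λ v → (λ j → φ j f) ∙ C v)            ≈⟨ ∙-congˡ g (λ v → trans (∙-comm (λ j → φ j f) (C v)) (Lf≈xf v)) ⟩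
      g ∙ (λ v → x * (degree v * f v))           ≈⟨ ∙-scale g x (λ v → degree v * f v) ⟩
      x * ⟨ g , f ⟩                              ∎

    -- By symmetry the energy of the pair equals both `x` and `y` times the inner product.
    eigenvectors-orthogonal : ∀ {x y f g} → IsEigenvector x f → IsEigenvector y g → x # y →
                              ⟨ f , g ⟩ ≈ 0#
    eigenvectors-orthogonal {x} {y} {f} {g} Lf≈xf Lg≈yg x#y = #-*-cancel x#y (begin
      x * ⟨ f , g ⟩ ≈⟨ *-congˡ (⟨⟩-sym f g) ⟩
      x * ⟨ g , f ⟩ ≈⟨ energy-eigenvector g Lf≈xf ⟨
      energy g f    ≈⟨ energy-sym g f ⟩
      energy f g    ≈⟨ energy-eigenvector f Lg≈yg ⟩
      y * ⟨ f , g ⟩ ∎)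

    IsEigenvector-zero : ∀ x → IsEigenvector x (λ _ → 0#)
    IsEigenvector-zero x v = begin
      C v ∙ (λ j → φ j (λ _ → 0#)) ≈⟨ sum-zero (λ j → trans (*-congˡ (sum-zero (λ w → zeroʳ (C w j))))
                                                            (zeroʳ (C v j))) ⟩
      0#                           ≈⟨ zeroʳ x ⟨
      x * 0#                       ≈⟨ *-congˡ (zeroʳ (degree v)) ⟨
      x * (degree v * 0#)          ∎

    IsEigenvector-combination : ∀ {n} x (a : Vector n) (e : Fin n → Vector N) →
      (∀ i → IsEigenvector x (e i)) → IsEigenvector x (combination a e)
    IsEigenvector-combination x a e Le≈xe v = begin
      C v ∙ (λ j → φ j (combination a e))        ≈⟨ ∙-congˡ (C v) (λ j → ∙-combination (λ w → C w j) a e) ⟩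
      C v ∙ (λ j → a ∙ (λ i → φ j (e i)))        ≈⟨ ∙-combination (C v) a (λ i j → φ j (e i)) ⟩
      a ∙ (λ i → C v ∙ (λ j → φ j (e i)))        ≈⟨ ∙-congˡ a (λ i → Le≈xe i v) ⟩
      a ∙ (λ i → x * (degree v * e i v))         ≈⟨ ∙-scale a x (λ i → degree v * e i v) ⟩
      x * a ∙ (λ i → degree v * e i v)           ≈⟨ *-congˡ (∙-scale a (degree v) (λ i → e i v)) ⟩
      x * (degree v * combination a e v)         ∎

    -- For each hyperedge, either `φ j f` vanishes or Cauchy-Schwarz on `h j` bounds its square by
    -- `b` times the sum of the `(C v j * f v)²`. Summed over `j` first, these squares give
    -- `degree v * (f v * f v)`.
    energy≤ : (h : Fin M → Subset N) → (∀ {v j} → v ∉ h j → C v j ≈ 0#) →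
              ∀ b f → (∀ j → φ j f ≈ 0# ⊎ ∣ h j ∣ ℕ.≤ b) → energy f f ≤ (b ⨯ 1#) * ⟨ f , f ⟩
    energy≤ h supp b f φ≈0⊎∣h∣≤b = ≤-resp-≈ refl total (sum-mono-≤ bound)
      where
      y : Fin M → Vector N
      y j v = C v j * f v
      y≈0 : ∀ {j v} → v ∉ h j → y j v ≈ 0#
      y≈0 v∉h = trans (*-congʳ (supp v∉h)) (zeroˡ _)
      y²-nonneg : ∀ j → 0# ≤ y j ∙ y j
      y²-nonneg j = sum-nonneg _ (λ v → 0≤x² (y j v))
      bound : ∀ j → φ j f * φ j f ≤ (b ⨯ 1#) * (y j ∙ y j)
      bound j with φ≈0⊎∣h∣≤b j
      ... | inj₁ φ≈0 = ≤-trans (≤-reflexive (trans (*-congʳ φ≈0) (trans (zeroˡ _) (sym (zeroʳ _)))))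
                               (*-monoʳ-≤ (⨯1-nonneg b) (y²-nonneg j))
      ... | inj₂ ∣h∣≤b = ≤-trans (cauchy-schwarz (h j) (y j) y≈0)
                                 (*-monoˡ-≤ (y²-nonneg j) (⨯1-mono-≤ ∣h∣≤b))
      total : sum (λ j → (b ⨯ 1#) * (y j ∙ y j)) ≈ (b ⨯ 1#) * ⟨ f , f ⟩
      total = begin
        sum (λ j → (b ⨯ 1#) * (y j ∙ y j))
          ≈⟨ *-distribˡ-sum (b ⨯ 1#) (λ j → y j ∙ y j) ⟨
        (b ⨯ 1#) * sum (λ j → sum (λ v → y j v * y j v))
          ≈⟨ *-congˡ (∑-comm (λ j v → y j v * y j v)) ⟩
        (b ⨯ 1#) * sum (λ v → sum (λ j → y j v * y j v))
          ≈⟨ *-congˡ (sum-cong (λ v → trans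
               (sum-cong (λ j → solve 2 (λ c f → (c :* f) :* (c :* f) := (c :* c) :* (f :* f)) refl
                                        (C v j) (f v)))
               (sym (*-distribʳ-sum (f v * f v) (λ j → C v j * C v j))))) ⟩
        (b ⨯ 1#) * sum (λ v → degree v * (f v * f v))
          ≈⟨ *-congˡ (⟨⟩-squares f) ⟨
        (b ⨯ 1#) * ⟨ f , f ⟩ ∎

    -- Sums of mutually orthogonal eigenvectors.

    module OrthogonalSum {n} (F : Fin n → Vector N)
                         (orthogonal : ∀ {r s} → s ≢ r → ⟨ F r , F s ⟩ ≈ 0#) where

      total : Vector N
      total v = sum (λ r → F r v)

      ⟨total,F⟩ : ∀ r → ⟨ total , F r ⟩ ≈ ⟨ F r , F r ⟩
      ⟨total,F⟩ r = begin
        ⟨ total , F r ⟩           ≈⟨ ⟨⟩-sym total (F r) ⟩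
        ⟨ F r , total ⟩           ≈⟨ ⟨⟩-sumʳ (F r) F ⟩
        sum (λ s → ⟨ F r , F s ⟩) ≈⟨ sum-single (λ s → ⟨ F r , F s ⟩) r (λ s → orthogonal) ⟩
        ⟨ F r , F r ⟩             ∎

      pythagoras : ⟨ total , total ⟩ ≈ sum (λ r → ⟨ F r , F r ⟩)
      pythagoras = trans (⟨⟩-sumʳ total F) (sum-cong ⟨total,F⟩)

      energy-total : (x : Vector n) → (∀ r → IsEigenvector (x r) (F r)) →
                     energy total total ≈ sum (λ r → x r * ⟨ F r , F r ⟩)
      energy-total x LF≈xF = trans (energy-sumʳ total F) (sum-cong λ r →
        trans (energy-eigenvector total (LF≈xF r)) (*-congˡ (⟨total,F⟩ r)))

      -- The energy hypothesis becomes `Σ x r ‖F r‖² ≤ b Σ ‖F r‖²`. Termwise the opposite inequality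
      -- holds, strictly wherever `b < x r` and `‖F r‖²` is positive, so no such term exists.
      components-vanish : (∀ v → 0# < degree v) → ∀ b (x : Vector n) →
        (∀ r → IsEigenvector (x r) (F r)) →
        (∀ r → b < x r ⊎ (∀ v → F r v ≈ 0#)) →
        energy total total ≤ b * ⟨ total , total ⟩ → ∀ r v → F r v ≈ 0#
      components-vanish 0<deg b x LF≈xF b<x⊎F≈0 energy≤b r with b<x⊎F≈0 r
      ... | inj₂ F≈0 = F≈0
      ... | inj₁ b<x = ⟨⟩-definite 0<deg (F r) λ 0<⟨F,F⟩ →
        ≤-resp-≈ (energy-total x LF≈xF)
                 (trans (*-congˡ pythagoras) (*-distribˡ-sum b (λ r → ⟨ F r , F r ⟩)))
                 energy≤b
          (sum-mono-< below r (strict 0<⟨F,F⟩))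
        where
        strict : 0# < ⟨ F r , F r ⟩ → b * ⟨ F r , F r ⟩ < x r * ⟨ F r , F r ⟩
        strict 0<⟨F,F⟩ = <-respˡ-≈ (*-comm _ _) (<-respʳ-≈ (*-comm _ _) (*-monoʳ-< 0<⟨F,F⟩ b<x))
        below : ∀ s → b * ⟨ F s , F s ⟩ ≤ x s * ⟨ F s , F s ⟩
        below s with b<x⊎F≈0 s
        ... | inj₁ b<xs = *-monoˡ-≤ (⟨⟩-nonneg (F s)) (<⇒≤ᵣ b<xs)
        ... | inj₂ F≈0  = ≤-reflexive (trans (vanish b) (sym (vanish (x s))))
          where
          vanish : ∀ a → a * ⟨ F s , F s ⟩ ≈ 0#
          vanish a = trans (*-congˡ (sum-zero λ v → trans (*-congʳ (F≈0 v)) (zeroˡ _))) (zeroʳ a)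

  -- Eigenbases of the Laplacian and the eigenvalue bound.

  combination-extend : ∀ {m n} (S : Subset n) (a : Vector n) (e : Fin ∣ S ∣ → Vector m) v →
    combination a (extend S e (λ _ → 0#)) v ≈ combination (restrict S a) e v
  combination-extend []          a e v = refl
  combination-extend (true  ∷ S) a e v = +-congˡ (combination-extend S (a ∘ suc) (e ∘ suc) v)
  combination-extend (false ∷ S) a e v =
    trans (+-cong (zeroʳ (a zero)) (combination-extend S (a ∘ suc) e v)) (+-identityˡ _)

  module Spectrum {N M} (Γ : Hypergraph ℝ N M) where
    open Hypergraph Γ
    open Coefficients C public

    0<deg : ∀ v → 0# < degree v
    0<deg v with covered v
    ... | j , v∈h = sum-pos (λ i → C v i * C v i) (λ i → 0≤x² (C v i)) j (x#0⇒0<x² (v∈h⇒C#0 v∈h))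

    eigenvector : ∀ {x f} → Eigenspace ℝ laplacian x f → IsEigenvector x f
    eigenvector {x} {f} Lf≈xf v = begin
      A                           ≈⟨ *-identityˡ A ⟨
      1# * A                      ≈⟨ *-congʳ deg*1/deg≈1 ⟨
      degree v * 1/deg v * A      ≈⟨ *-assoc (degree v) (1/deg v) A ⟩
      degree v * (1/deg v * A)    ≈⟨ *-congˡ (Lf≈xf v) ⟩
      degree v * (x * f v)        ≈⟨ solve 3 (λ d x f → d :* (x :* f) := x :* (d :* f)) refl (degree v) x (f v) ⟩
      x * (degree v * f v)        ∎
      where
      A = C v ∙ (λ j → φ j f)
      deg*1/deg≈1 : degree v * 1/deg v ≈ 1#
      deg*1/deg≈1 = trans (*-congʳ (sym (x-0≈x (degree v)))) (proj₂ (proj₂ (#⇒invertible (deg#0 v))))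

    module _ {ev : Vector N} (isSpectrum : IsSpectrum ℝ laplacian ev) (ev≈#ev : ev ≈# ev) where
      open IsSpectrum isSpectrum

      ev≟ev : ∀ i j → Dec (ev i ≈ ev j)
      ev≟ev i j with ev≈#ev i j
      ... | inj₁ i≈j = yes i≈j
      ... | inj₂ i#j = no λ i≈j → #-irrefl i≈j i#j

      ev≉⇒# : ∀ {i j} → ¬ (ev i ≈ ev j) → ev i # ev j
      ev≉⇒# {i} {j} i≉j = [ (λ i≈j → contradiction i≈j i≉j) , id ]′ (ev≈#ev i j)

      reps = representatives {_~_ = λ i j → ev i ≈ ev j}
        (record { refl = refl ; sym = sym ; trans = trans }) ev≟ev

      rep : Fin N → Fin N
      rep = proj₁ reps

      ev-rep : ∀ i → ev (rep i) ≈ ev i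
      ev-rep = proj₁ (proj₂ reps)

      rep-cong : ∀ {i j} → ev i ≈ ev j → rep i ≡ rep j
      rep-cong = proj₂ (proj₂ reps)

      -- Empty unless `r` is its own representative; otherwise the set of all positions at which
      -- `ev r` occurs.
      class : Fin N → Subset N
      class r = Vec.tabulate (λ i → does (rep i Fin.≟ r))

      class⁺ : ∀ {i r} → rep i ≡ r → i ∈ class r
      class⁺ {i} {r} rep≡r = Vec.lookup⇒[]= i (class r)
        (≡.trans (Vec.lookup∘tabulate _ i) (dec-true (rep i Fin.≟ r) rep≡r))

      class⁻ : ∀ {i r} → i ∈ class r → rep i ≡ r
      class⁻ {i} {r} i∈class with rep i Fin.≟ r
        | ≡.trans (≡.sym (Vec.lookup∘tabulate (λ i → does (rep i Fin.≟ r)) i)) (Vec.[]=⇒lookup i∈class)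
      ... | yes rep≡r | _ = rep≡r
      ... | no _      | ()

      -- Distinct members of a class of equal eigenvalues come with unrelated bases
      -- of the same eigenspace, so only the basis at the representative of each
      -- class is used; at any other r the family is zero.
      Eigenbasis : Fin N → Set _
      Eigenbasis r = Σ[ e ∈ (Fin N → Vector N) ]
          (∀ i → IsEigenvector (ev r) (e i))
        × (∀ i → rep i ≢ r → ∀ v → e i v ≈ 0#)
        × (∀ a → (∀ v → combination a e v ≈ 0#) → ∀ i → rep i ≡ r → a i ≈ 0#)

      eigenbasis : ∀ r → Eigenbasis r
      eigenbasis r with rep r Fin.≟ r
      ... | no rep≢r =
        (λ _ _ → 0#) , (λ _ → IsEigenvector-zero (ev r)) , (λ _ _ _ → refl) ,
        -- By idempotence of `rep`, an `r` with `rep r ≢ r` represents no position, so independence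
        -- is vacuous.
        λ { _ _ i ≡.refl → contradiction (rep-cong (ev-rep i)) rep≢r }
      ... | yes rep≡r with multiplicity (ev r) (class r)
          (λ {i} i∈ → trans (sym (ev-rep i)) (reflexive (≡.cong ev (class⁻ i∈))))
          (λ {i} i∉ → ev≉⇒# λ i≈r → i∉ (class⁺ (≡.trans (rep-cong i≈r) rep≡r)))
      ...   | b , Lb≈xb , independent , _ =
        extend (class r) b (λ _ → 0#) ,
        extend⁺ (IsEigenvector (ev r)) (class r) (eigenvector ∘ Lb≈xb) (IsEigenvector-zero (ev r)) ,
        (λ i rep≢r v → reflexive (≡.cong-app (extend-∉ (class r) (rep≢r ∘ class⁻)) v)) ,
        λ a ae≈0 i rep≡r → restrict⁻ (_≈ 0#) (class r)
          (independent (restrict (class r) a)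
            (λ v → trans (sym (combination-extend (class r) a b v)) (ae≈0 v)))
          (class⁺ rep≡r)

      e : Fin N → Fin N → Vector N
      e r = proj₁ (eigenbasis r)

      -- The part in the eigenspace of `ev r` of the vector with coordinates `a`. That vector is the
      -- sum of all components, and `a i` enters only the component at `rep i`.
      component : Vector N → Fin N → Vector N
      component a r = combination a (e r)

      component-eigenvector : ∀ a r → IsEigenvector (ev r) (component a r)
      component-eigenvector a r =
        IsEigenvector-combination (ev r) a (e r) (proj₁ (proj₂ (eigenbasis r)))

      component-zero : ∀ a r → (∀ i → rep i ≡ r → a i ≈ 0#) → ∀ v → component a r v ≈ 0#
      component-zero a r a≈0 v = sum-zero λ i → term i (rep i Fin.≟ r)
        where
        term : ∀ i → Dec (rep i ≡ r) → a i * e r i v ≈ 0#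
        term i (yes rep≡r) = trans (*-congʳ (a≈0 i rep≡r)) (zeroˡ _)
        term i (no rep≢r)  = trans (*-congˡ (proj₁ (proj₂ (proj₂ (eigenbasis r))) i rep≢r v)) (zeroʳ _)

      -- If `ev r` and `ev s` are apart, eigenvectors are orthogonal. If they are equal, at most one
      -- of the distinct `r` and `s` is a representative, and the component at the other is zero.
      component-orthogonal : ∀ a {r s} → s ≢ r → ⟨ component a r , component a s ⟩ ≈ 0#
      component-orthogonal a {r} {s} s≢r = cases (ev≈#ev r s) (rep r Fin.≟ r)
        where
        s-empty : ev r ≈ ev s → rep r ≡ r → ∀ i → rep i ≡ s → a i ≈ 0#
        s-empty r≈s rep≡r i ≡.refl = contradiction
          (≡.trans (≡.sym (rep-cong (ev-rep i))) (≡.trans (≡.sym (rep-cong r≈s)) rep≡r)) s≢r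
        r-empty : rep r ≢ r → ∀ i → rep i ≡ r → a i ≈ 0#
        r-empty rep≢r i ≡.refl = contradiction (rep-cong (ev-rep i)) rep≢r
        cases : ev r ≈ ev s ⊎ ev r # ev s → Dec (rep r ≡ r) →
                ⟨ component a r , component a s ⟩ ≈ 0#
        cases (inj₂ r#s) _ =
          eigenvectors-orthogonal (component-eigenvector a r) (component-eigenvector a s) r#s
        cases (inj₁ r≈s) (yes rep≡r) = sum-zero λ v → trans
          (*-congˡ (trans (*-congˡ (component-zero a s (s-empty r≈s rep≡r) v)) (zeroʳ _))) (zeroʳ _)
        cases (inj₁ _) (no rep≢r) = sum-zero λ v →
          trans (*-congʳ (component-zero a r (r-empty rep≢r) v)) (zeroˡ _)

      components-zero⇒coefficients-zero : ∀ a → (∀ r v → component a r v ≈ 0#) → ∀ i → a i ≈ 0#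
      components-zero⇒coefficients-zero a F≈0 i =
        proj₂ (proj₂ (proj₂ (eigenbasis (rep i)))) a (F≈0 (rep i)) i ≡.refl

      -- Displays the vanishing of `φ j` as a linear equation in the coordinates `a`, the form that
      -- `kernel-supported` solves.
      φ-total : ∀ a j → φ j (λ v → sum (λ r → component a r v)) ≈
                        (λ i → sum (λ r → φ j (e r i))) ∙ a
      φ-total a j = begin
        φ j (λ v → sum (λ r → component a r v)) ≈⟨ ∙-sum (λ w → C w j) (component a) ⟩
        sum (λ r → φ j (component a r))         ≈⟨ sum-cong (λ r → ∙-combination (λ w → C w j) a (e r)) ⟩
        sum (λ r → a ∙ (λ i → φ j (e r i)))     ≈⟨ ∙-sum a (λ r i → φ j (e r i)) ⟨
        a ∙ (λ i → sum (λ r → φ j (e r i)))     ≈⟨ ∙-comm a _ ⟩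
        (λ i → sum (λ r → φ j (e r i))) ∙ a     ∎

      ev<⊎≥⇒≤ : ∀ {k} (k<N : k ℕ.< N) b (J : Fin k → Fin M) →
        (∀ j → (∃[ t ] J t ≡ j) ⊎ ∣ edge j ∣ ℕ.≤ b) →
        (∀ r → b ⨯ 1# < ev r ⊎ ev r ≤ b ⨯ 1#) →
        ev (fromTop k k<N) ≤ b ⨯ 1#
      ev<⊎≥⇒≤ {k} k<N b J small b<⊎≥ b<ev =
        kernel-supported (toℕ (fromTop k k<N)) k+top<N (λ t i → sum (λ r → φ (J t) (e r i)))
        λ { ((a , (i , aᵢ#0) , Ja≈0) , supp) → #-irrefl
          (components-zero⇒coefficients-zero a (vanish a Ja≈0 supp) i) aᵢ#0 }
        where
        -- `fromTop k` sits at position `N - (k + 1)`, so `k + 1` coordinates remain free against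
        -- `k` equations.
        k+top<N : k ℕ.+ toℕ (fromTop k k<N) ℕ.< N
        k+top<N = ℕ.≤-reflexive (≡.trans
          (≡.cong (λ t → suc (k ℕ.+ t)) (≡.trans (Fin.opposite-prop (fromℕ< k<N))
            (≡.cong (λ t → N ℕ.∸ suc t) (Fin.toℕ-fromℕ< k<N))))
          (ℕ.m+[n∸m]≡n k<N))
        module _ (a : Vector N)
                 (Ja≈0 : ∀ t → (λ i → sum (λ r → φ (J t) (e r i))) ∙ a ≈ 0#)
                 (supp : ∀ i → toℕ i ℕ.< toℕ (fromTop k k<N) → a i ≈ 0#) where
          open OrthogonalSum (component a) (component-orthogonal a)
          φ≈0⊎small : ∀ j → φ j total ≈ 0# ⊎ ∣ edge j ∣ ℕ.≤ b
          φ≈0⊎small j with small j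
          ... | inj₁ (t , ≡.refl) = inj₁ (trans (φ-total a (J t)) (Ja≈0 t))
          ... | inj₂ ∣h∣≤b        = inj₂ ∣h∣≤b
          large⊎zero : ∀ r → b ⨯ 1# < ev r ⊎ (∀ v → component a r v ≈ 0#)
          large⊎zero r with b<⊎≥ r
          ... | inj₁ b<evr = inj₁ b<evr
          -- A position of this class at or above `fromTop k` would have eigenvalue above `b` by
          -- sortedness. All of them lie below, where `a` is zero.
          ... | inj₂ evr≤b = inj₂ (component-zero a r λ { i ≡.refl →
            supp i (ℕ.≰⇒> λ top≤i →
              evr≤b (<-respʳ-≈ (sym (ev-rep i)) (<-≤-trans b<ev (sorted top≤i)))) })
          vanish : ∀ r v → component a r v ≈ 0#
          vanish = components-vanish 0<deg (b ⨯ 1#) ev (component-eigenvector a) large⊎zero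
            (energy≤ edge v∉h⇒C≈0 b total φ≈0⊎small)

    eigenvalue≤ : ∀ {ev : Vector N} → IsSpectrum ℝ laplacian ev →
      ∀ {k} (k<N : k ℕ.< N) b (J : Fin k → Fin M) →
      (∀ j → (∃[ t ] J t ≡ j) ⊎ ∣ edge j ∣ ℕ.≤ b) → ev (fromTop k k<N) ≤ b ⨯ 1#
    eigenvalue≤ {ev} isSpectrum k<N b J small b<ev =
      ¬¬-sequence (λ i → ¬¬-sequence (λ j → ≈⊎# (ev i) (ev j))) λ ev≈#ev →
      ¬¬-sequence b<⊎≥ λ b<⊎≥ → ev<⊎≥⇒≤ isSpectrum ev≈#ev k<N b J small b<⊎≥ b<ev
      where
      b<⊎≥ : ∀ r → ¬ ¬ (b ⨯ 1# < ev r ⊎ ev r ≤ b ⨯ 1#)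
      -- The second alternative is by definition the negation of the first.
      b<⊎≥ r k = k (inj₂ (k ∘ inj₁))

-- The ordered hyperedges and the maximum.

largestEdges : ∀ {k M} → Permutation′ M → k ℕ.< M → Fin k → Fin M
largestEdges π k<M t = π ⟨$⟩ʳ fromTop (toℕ t) (ℕ.<-trans (Fin.toℕ<n t) k<M)

module _ {c ℓ₁ ℓ₂} (ℝ : RealField c ℓ₁ ℓ₂) {N M} (Γ : Hypergraph ℝ N M) (π : Permutation′ M)
         (sorted : ∀ {i j} → i Fin.≤ j → Hypergraph.card Γ π i ℕ.≤ Hypergraph.card Γ π j) where
  open Hypergraph Γ

  -- `toℕ (opposite (π ⟨$⟩ˡ j))` counts the positions after that of `j`. If it is below `k`, it is
  -- the index `t` sought; otherwise `j` comes no later than `fromTop k`, and sortedness applies.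
  top⊎small : ∀ {k} (k<M : k ℕ.< M) j →
              (∃[ t ] largestEdges π k<M t ≡ j) ⊎ ∣ edge j ∣ ℕ.≤ card π (fromTop k k<M)
  top⊎small {k} k<M j with toℕ (opposite (π ⟨$⟩ˡ j)) ℕ.<? k
  ... | yes i<k = inj₁ (fromℕ< i<k , (begin
    π ⟨$⟩ʳ opposite (fromℕ< _)
      ≡⟨ ≡.cong (λ i → π ⟨$⟩ʳ opposite i)
                (Fin.toℕ-injective (≡.trans (Fin.toℕ-fromℕ< _) (Fin.toℕ-fromℕ< i<k))) ⟩
    π ⟨$⟩ʳ opposite (opposite (π ⟨$⟩ˡ j)) ≡⟨ ≡.cong (π ⟨$⟩ʳ_) (Fin.opposite-involutive (π ⟨$⟩ˡ j)) ⟩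
    π ⟨$⟩ʳ (π ⟨$⟩ˡ j)                    ≡⟨ inverseʳ π ⟩
    j                                    ∎))
    where open ≡.≡-Reasoning
  ... | no i≮k = inj₂ (≡.subst (λ j → ∣ edge j ∣ ℕ.≤ _) (inverseʳ π) (sorted (begin
    toℕ (π ⟨$⟩ˡ j)                       ≡⟨ ≡.cong toℕ (Fin.opposite-involutive (π ⟨$⟩ˡ j)) ⟨
    toℕ (opposite (opposite (π ⟨$⟩ˡ j))) ≡⟨ Fin.opposite-prop (opposite (π ⟨$⟩ˡ j)) ⟩
    M ℕ.∸ suc (toℕ (opposite (π ⟨$⟩ˡ j))) ≤⟨ ℕ.∸-monoʳ-≤ M (s≤s (ℕ.≮⇒≥ i≮k)) ⟩
    M ℕ.∸ suc k                          ≡⟨ ≡.cong (λ t → M ℕ.∸ suc t) (Fin.toℕ-fromℕ< k<M) ⟨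
    M ℕ.∸ suc (toℕ (fromℕ< k<M))         ≡⟨ Fin.opposite-prop (fromℕ< k<M) ⟨
    toℕ (fromTop k k<M)                  ∎)))
    where open ℕ.≤-Reasoning

≤maxℤ : ∀ {k} (t : Fin (suc k) → ℤ.ℤ) i → t i ℤ.≤ maxℤ t
≤maxℤ {zero}  t zero    = ℤ.≤-refl
≤maxℤ {suc k} t zero    = ℤ.i≤i⊔j _ _
≤maxℤ {suc k} t (suc i) = ℤ.≤-trans (≤maxℤ (t ∘ suc) i) (ℤ.i≤j⊔i _ _)

n-k+k≡n : ∀ n k → + n ℤ.- + k ℤ.+ + k ≡ + n
n-k+k≡n n k = ≡.trans (ℤ.+-assoc (+ n) (ℤ.- + k) (+ k))
  (≡.trans (≡.cong (ℤ._+_ (+ n)) (ℤ.+-inverseˡ (+ k))) (ℤ.+-identityʳ (+ n)))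

open RealField using (Carrier; _≤_; fromℤ)
open Hypergraph using (laplacian; card)

mainTheorem9 : ∀ {c ℓ₁ ℓ₂} (ℝ : RealField c ℓ₁ ℓ₂) (N M : ℕ) (Γ : Hypergraph ℝ N M)
    (ev : Fin N → Carrier ℝ) → IsSpectrum ℝ (laplacian Γ) ev →
    (π : Permutation′ M) → (∀ {i j} → i Fin.≤ j → card Γ π i ℕ.≤ card Γ π j) →
    ((1<N : 1 ℕ.< N) (1<M : 1 ℕ.< M) →
    _≤_ ℝ (ev (fromTop 1 1<N))
    (fromℤ ℝ ((+ card Γ π (fromTop 0 (<⇒≤ 1<M)) ℤ.- + 1)
    ℤ.⊔ (+ card Γ π (fromTop 1 1<M)))))
    × (∀ k → 1 ℕ.≤ k → (k<N : k ℕ.< N) (k<M : k ℕ.< M) →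
    _≤_ ℝ (ev (fromTop k k<N))
    (fromℤ ℝ (maxℤ {k} (λ i →
    (+ card Γ π (fromTop (toℕ i) (toℕ<M i k<M))) ℤ.- (+ k) ℤ.+ (+ toℕ i)))))
mainTheorem9 ℝ N M Γ ev isSpectrum π sorted =
    (λ 1<N 1<M → bound 1<N 1<M
      (ℤ.i≤j⊔i (+ card Γ π (fromTop 0 (<⇒≤ 1<M)) ℤ.- + 1) (+ card Γ π (fromTop 1 1<M))))
  , (λ k _ k<N k<M → bound k<N k<M
      (ℤ.≤-trans (ℤ.≤-reflexive (≡.sym (last k k<M))) (≤maxℤ (term k k<M) (fromℕ k))))
  where
  open RealFieldProperties ℝ using (≤-trans; ⨯1≤fromℤ; module Spectrum)
  term : ∀ k → k ℕ.< M → Fin (suc k) → ℤ.ℤ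
  term k k<M i = + card Γ π (fromTop (toℕ i) (toℕ<M i k<M)) ℤ.- + k ℤ.+ + toℕ i
  last : ∀ k (k<M : k ℕ.< M) → term k k<M (fromℕ k) ≡ + card Γ π (fromTop k k<M)
  last k k<M = ≡.trans
    (≡.cong₂ (λ i m → + card Γ π (opposite i) ℤ.- + k ℤ.+ + m)
      -- The two indices carry different proofs of their bound, hence a congruence on values.
      (Fin.fromℕ<-cong _ _ (Fin.toℕ-fromℕ k) (toℕ<M (fromℕ k) k<M) k<M) (Fin.toℕ-fromℕ k))
    (n-k+k≡n (card Γ π (fromTop k k<M)) k)
  bound : ∀ {k z} (k<N : k ℕ.< N) (k<M : k ℕ.< M) → + card Γ π (fromTop k k<M) ℤ.≤ z →
          _≤_ ℝ (ev (fromTop k k<N)) (fromℤ ℝ z)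
  bound k<N k<M card≤z = ≤-trans
    (Spectrum.eigenvalue≤ Γ isSpectrum k<N _ (largestEdges π k<M) (top⊎small ℝ Γ π sorted k<M))
    (⨯1≤fromℤ card≤z)
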